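{- Let $n$ be a positive integer. For $0 \le m \le l \le n$ let $g_n(m,l)$ be the smallest integer $k \ge 0$ such that there exists a cutset $\mathcal{C} \subseteq 2^{[n]}$ containing exactly $k$ subsets of size $i$ for each $m \le i \le l$ and no subsets of any other size. Then: (1) $g_n(m,m)=\binom{n}{m}$ for every integer $0 \le m \le n$; (2) $g_n(m,m+1)=\binom{n-1}{m}$ for every integer $0 \le m \le n-1$; (3) $g_n(m,m+2)=\sum_{j=0}^{m}\binom{n-2j-2}{m-j}$ for every integer $0 \le m \le n/2-1$.
   Context: $[n]=\{1,\dots,n\}$ and $2^{[n]}$ is the set of all subsets of $[n]$ ordered by inclusion. A maximal chain in $2^{[n]}$ is a chain $A_0 \subset A_1 \subset \cdots \subset A_n$ with $|A_i|=i$. A cutset is a collection $\mathcal{C} \subseteq 2^{[n]}$ that meets every maximal chain. The $f$-vector (profile) of $\mathcal{A}\subseteq 2^{[n]}$ is $(f_0,\dots,f_n)$ with $f_i$ the number of members of $\mathcal{A}$ of size $i$; thus $g_n(m,l)$ is the least $k$ such that the vector with $f_i=k$ for $m\le i\le l$ and $f_i=0$ otherwise is the $f$-vector of a cutset. -}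

module Defs where

open import Data.Nat using (ℕ; zero; suc; _+_; _*_; _∸_; _≤_; _<_)
open import Data.Nat.Properties using (_≟_)
open import Data.Fin using (Fin; toℕ; inject₁) renaming (suc to fsuc)
open import Data.Fin.Subset using (Subset; _⊆_; ∣_∣)
open import Data.List using (List; length; filter; map; upTo)
open import Data.Nat.ListAction using (sum)
open import Data.List.Membership.Propositional using (_∈_)
open import Data.List.Relation.Unary.Unique.Propositional using (Unique)
open import Data.Product using (Σ; ∃; _×_)
open import Data.Sum using (_⊎_)
open import Data.Nat.Combinatorics using (_C_)
open import Relation.Binary.PropositionalEquality using (_≡_)

record MaximalChain (n : ℕ) : Set where
  field
    set  : Fin (suc n) → Subset n
    size : ∀ i → ∣ set i ∣ ≡ toℕ i
    incl : ∀ (i : Fin n) → set (inject₁ i) ⊆ set (fsuc i)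

-- A (finite) family of subsets of [n]: a duplicate-free list.
Family : ℕ → Set
Family n = List (Subset n)

IsCutset : ∀ {n} → Family n → Set
IsCutset {n} 𝒞 = ∀ (c : MaximalChain n) → ∃ λ i → MaximalChain.set c i ∈ 𝒞

fvec : ∀ {n} → Family n → ℕ → ℕ
fvec 𝒞 i = length (filter (λ A → ∣ A ∣ ≟ i) 𝒞)

HasProfile : ∀ {n} → ℕ → ℕ → ℕ → Family n → Set
HasProfile m l k 𝒞 =
  ∀ i → ((m ≤ i → i ≤ l → fvec 𝒞 i ≡ k) × ((i < m ⊎ l < i) → fvec 𝒞 i ≡ 0))

Attained : ℕ → ℕ → ℕ → ℕ → Set
Attained n m l k = Σ (Family n) λ 𝒞 → Unique 𝒞 × IsCutset 𝒞 × HasProfile m l k 𝒞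

IsG : ℕ → ℕ → ℕ → ℕ → Set
IsG n m l k = Attained n m l k × (∀ k′ → Attained n m l k′ → k ≤ k′)

sum3 : ℕ → ℕ → ℕ
sum3 n m = sum (map (λ j → (n ∸ (2 * j + 2)) C (m ∸ j)) (upTo (suc m)))

{-# OPTIONS --safe #-}

-- Upper bounds: for two levels, take the sets whose trace outside the first point has size m.  For three levels,
-- a set with trace ∅, {1} or {1,2} on the first two points is taken when the rest of it has size m; a chain
-- missing all of these has constant trace {2}, so recursing on the remaining n − 2 points with m − 1 suffices.
--
-- Lower bounds: the sets of the top level outside the cutset have a shadow; the part of this shadow outside the
-- cutset has again a shadow, and so on, until the bottom level, where the shadow lies in the cutset.  The sizes
-- are controlled by the Kruskal–Katona theorem for the cascades C(N,r) + C(N−2,r−1) + C(N−4,r−2) + ⋯.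
-- The latter follows by induction on n once F is compressed by shifts so that the shadow of the members
-- avoiding the first point is no larger than the link of that point (Frankl's argument).

module Submission where

open import Defs
open import Data.Bool as Bool using (Bool; T; true; false; _∧_; _∨_; not; if_then_else_)
open import Data.Bool.Properties using (∨-comm; ∨-assoc; ¬-not)
open import Data.Empty using (⊥-elim)
open import Data.Fin using (Fin; toℕ; fromℕ<) renaming (zero to fzero; suc to fsuc)
open import Data.Fin.Properties using (toℕ-inject₁; toℕ-fromℕ<; toℕ-injective; toℕ<n)
open import Data.Fin.Subset using (Subset; ∣_∣; _⊆_; ⊥; ⊤)
open import Data.Fin.Subset.Properties using (∣⊥∣≡0; ∣⊤∣≡n; ⊆-refl; out⊆; s⊆s; drop-∷-⊆)
open import Data.List using ([]; _∷_; _++_; map; filter; length; applyUpTo)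
open import Data.List.Membership.Propositional using (_∈_)
open import Data.List.Membership.Propositional.Properties
  using (∈-filter⁺; ∈-filter⁻; ∈-map⁺; ∈-map⁻; ∈-++⁺ˡ; ∈-++⁺ʳ)
open import Data.List.Properties using (map-upTo; filter-accept; filter-reject)
open import Data.List.Relation.Unary.All as All using (lookup)
open import Data.List.Relation.Unary.AllPairs using ([]; _∷_)
open import Data.List.Relation.Unary.Any using (here)
open import Data.List.Relation.Unary.Unique.Propositional using (Unique)
open import Data.List.Relation.Unary.Unique.Propositional.Properties using (map⁺; ++⁺; filter⁺)
open import Data.Nat using (ℕ; zero; suc; pred; _+_; _*_; _∸_; _≤_; _<_; z≤n; s≤s)
open import Data.Nat.Combinatorics using (_C_; nCk+nC[k+1]≡[n+1]C[k+1]; nCk≡nC[n∸k]; nCn≡1)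
open import Data.Nat.Induction using (<-wellFounded)
open import Data.Nat.ListAction using (sum)
open import Data.Nat.Properties
open import Data.Nat.Tactic.RingSolver using (solve-∀)
open import Data.Product using (∃; ∃₂; _×_; _,_; proj₁; proj₂)
open import Data.Sum using (_⊎_; inj₁; inj₂; [_,_]′)
open import Data.Unit using (tt)
open import Data.Vec using ([]; _∷_; here)
open import Data.Vec.Properties using (≡-dec; ∷-injectiveʳ)
open import Function using (_∘_)
open import Induction.WellFounded using (Acc; acc)
open import Relation.Binary.Construct.Closure.ReflexiveTransitive using (Star; ε; _◅_; _◅◅_; gmap)
open import Relation.Binary.PropositionalEquality hiding ([_])
open import Relation.Nullary using (yes; no; does; ¬_; Dec)
open import Relation.Nullary.Decidable using (dec-true; dec-false)
open import Algebra.Properties.CommutativeSemigroup +-commutativeSemigroup using (interchange)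

-- Families as Boolean indicators and the sizes of their levels

Indicator : ℕ → Set
Indicator n = Subset n → Bool

lo hi : ∀ {n} → Indicator (suc n) → Indicator n
lo F x = F (false ∷ x)
hi F x = F (true ∷ x)

infixr 7 _∩_
infixr 6 _∪_
infix 4 _⊑_

_∩_ _∪_ : ∀ {n} → Indicator n → Indicator n → Indicator n
(F ∩ G) x = F x ∧ G x
(F ∪ G) x = F x ∨ G x

∁ : ∀ {n} → Indicator n → Indicator n
∁ F x = not (F x)

_⊑_ : ∀ {n} → Indicator n → Indicator n → Set
F ⊑ G = ∀ x → F x ≡ true → G x ≡ true

∨-elim : ∀ {a b} → a ∨ b ≡ true → a ≡ true ⊎ b ≡ true
∨-elim {true}  _ = inj₁ refl
∨-elim {false} p = inj₂ p

∨-introˡ : ∀ {a} b → a ≡ true → a ∨ b ≡ true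
∨-introˡ _ refl = refl

∨-introʳ : ∀ a {b} → b ≡ true → a ∨ b ≡ true
∨-introʳ true  _ = refl
∨-introʳ false p = p

∧-elim : ∀ {a b} → a ∧ b ≡ true → a ≡ true × b ≡ true
∧-elim {true} p = refl , p

∧-intro : ∀ {a b} → a ≡ true → b ≡ true → a ∧ b ≡ true
∧-intro refl p = p

∨-mono : ∀ {a b c d} → (a ≡ true → c ≡ true) → (b ≡ true → d ≡ true) → a ∨ b ≡ true → c ∨ d ≡ true
∨-mono {c = c} f g p = [ ∨-introˡ _ ∘ f , ∨-introʳ c ∘ g ]′ (∨-elim p)

∧-mono : ∀ {a b c d} → (a ≡ true → c ≡ true) → (b ≡ true → d ≡ true) → a ∧ b ≡ true → c ∧ d ≡ true
∧-mono f g p with ∧-elim p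
... | q , r = ∧-intro (f q) (g r)

-- Branching on the first point makes the split of level `suc r` into `lo` and `hi` hold by
-- computation, in parallel with Pascal's rule.
lev : ∀ {n} → ℕ → Indicator n → ℕ
lev {zero}  zero    F = if F [] then 1 else 0
lev {zero}  (suc r) F = 0
lev {suc n} zero    F = lev zero (lo F)
lev {suc n} (suc r) F = lev (suc r) (lo F) + lev r (hi F)

lev-mono : ∀ {n} r {F G : Indicator n} → (∀ x → ∣ x ∣ ≡ r → F x ≡ true → G x ≡ true) → lev r F ≤ lev r G
lev-mono {zero}  zero    {F} {G} h with F [] | h [] refl
... | false | _ = z≤n
... | true  | q with G [] | q refl
...   | true | _ = ≤-refl
lev-mono {zero}  (suc r) h = z≤n
lev-mono {suc n} zero    h = lev-mono zero (λ x e → h (false ∷ x) e)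
lev-mono {suc n} (suc r) h =
  +-mono-≤ (lev-mono (suc r) (λ x e → h (false ∷ x) e)) (lev-mono r (λ x e → h (true ∷ x) (cong suc e)))

lev-cong : ∀ {n} r {F G : Indicator n} → F ≗ G → lev r F ≡ lev r G
lev-cong r e = ≤-antisym (lev-mono r (λ x _ p → trans (sym (e x)) p)) (lev-mono r (λ x _ p → trans (e x) p))

-- The modular law yields both subadditivity and the invariance of level sizes under shifts.
lev-∩∪ : ∀ {n} r (F G : Indicator n) → lev r (F ∩ G) + lev r (F ∪ G) ≡ lev r F + lev r G
lev-∩∪ {zero}  zero    F G with F [] | G []
... | false | false = refl
... | false | true  = refl
... | true  | false = refl
... | true  | true  = refl
lev-∩∪ {zero}  (suc r) F G = refl
lev-∩∪ {suc n} zero    F G = lev-∩∪ zero (lo F) (lo G)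
lev-∩∪ {suc n} (suc r) F G = begin
  (a + b) + (c + d)   ≡⟨ interchange a b c d ⟩
  (a + c) + (b + d)   ≡⟨ cong₂ _+_ (lev-∩∪ (suc r) (lo F) (lo G)) (lev-∩∪ r (hi F) (hi G)) ⟩
  (a′ + c′) + (b′ + d′) ≡⟨ interchange a′ c′ b′ d′ ⟩
  (a′ + b′) + (c′ + d′) ∎
  where
    open ≡-Reasoning
    a = lev (suc r) (lo F ∩ lo G)
    b = lev r (hi F ∩ hi G)
    c = lev (suc r) (lo F ∪ lo G)
    d = lev r (hi F ∪ hi G)
    a′ = lev (suc r) (lo F)
    b′ = lev r (hi F)
    c′ = lev (suc r) (lo G)
    d′ = lev r (hi G)

lev-∪-≤ : ∀ {n} r (F G : Indicator n) → lev r (F ∪ G) ≤ lev r F + lev r G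
lev-∪-≤ r F G = ≤-trans (m≤n+m _ _) (≤-reflexive (lev-∩∪ r F G))

<-split : ∀ {a b c d} → a + b < c + d → a < c ⊎ b < d
<-split {a} {b} {c} {d} p with a <? c
... | yes q = inj₁ q
... | no ¬q with b <? d
...   | yes q = inj₂ q
...   | no ¬r = ⊥-elim (<⇒≱ p (+-mono-≤ (≮⇒≥ ¬q) (≮⇒≥ ¬r)))

-- A strict inequality between sums is strict in one of the summands, so it can be followed down to
-- a single set. This turns a failed size comparison into a set to shift.
lev-<-witness : ∀ {n} r (F G : Indicator n) → lev r F < lev r G →
                ∃ λ x → ∣ x ∣ ≡ r × F x ≡ false × G x ≡ true
lev-<-witness {zero}  zero    F G p with F [] in e | G [] in e′
lev-<-witness {zero}  zero    F G (s≤s ()) | true  | true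
lev-<-witness {zero}  zero    F G _        | false | true = [] , refl , e , e′
lev-<-witness {suc n} zero    F G p with lev-<-witness zero (lo F) (lo G) p
... | x , s , f , g = false ∷ x , s , f , g
lev-<-witness {suc n} (suc r) F G p with <-split p
... | inj₁ q with lev-<-witness (suc r) (lo F) (lo G) q
...   | x , s , f , g = false ∷ x , s , f , g
lev-<-witness {suc n} (suc r) F G p | inj₂ q with lev-<-witness r (hi F) (hi G) q
...   | x , s , f , g = true ∷ x , cong suc s , f , g

-- Makes the number of members avoiding the first point a termination measure for compression.
lev-strict : ∀ {n} r (F G : Indicator n) → F ⊑ G → ∀ y → ∣ y ∣ ≡ r → F y ≡ false → G y ≡ true → lev r F < lev r G
lev-strict zero    F G F⊑G []          e f g rewrite f | g = ≤-refl
lev-strict (suc r) F G F⊑G (true ∷ y)  e f g = +-mono-≤-< (lev-mono (suc r) (λ x _ → F⊑G (false ∷ x)))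
  (lev-strict r (hi F) (hi G) (F⊑G ∘ (true ∷_)) y (suc-injective e) f g)
lev-strict zero    F G F⊑G (false ∷ y) e f g = lev-strict zero (lo F) (lo G) (F⊑G ∘ (false ∷_)) y e f g
lev-strict (suc r) F G F⊑G (false ∷ y) e f g = +-mono-<-≤
  (lev-strict (suc r) (lo F) (lo G) (F⊑G ∘ (false ∷_)) y e f g) (lev-mono r (λ x _ → F⊑G (true ∷ x)))

lev-∪ˡ : ∀ {n} r (F G : Indicator n) → lev r F ≤ lev r (F ∪ G)
lev-∪ˡ r F G = lev-mono r (λ x _ → ∨-introˡ (G x))

-- Shadows and shifts

-- The shadow of all levels at once: its level `r` depends only on level `suc r` of `F`. The
-- disjunct `hi F x` accounts for deleting the first point.
∂ : ∀ {n} → Indicator n → Indicator n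
∂ F []          = false
∂ F (true  ∷ x) = ∂ (hi F) x
∂ F (false ∷ x) = hi F x ∨ ∂ (lo F) x

∂-mono : ∀ {n} {F G : Indicator n} → F ⊑ G → ∂ F ⊑ ∂ G
∂-mono h (true  ∷ x) p = ∂-mono (h ∘ (true ∷_)) x p
∂-mono h (false ∷ x) p = ∨-mono (h (true ∷ x)) (∂-mono (h ∘ (false ∷_)) x) p

∂-∪ : ∀ {n} (F G : Indicator n) → ∂ (F ∪ G) ⊑ ∂ F ∪ ∂ G
∂-∪ F G (true  ∷ x) p = ∂-∪ (hi F) (hi G) x p
∂-∪ F G (false ∷ x) p with ∨-elim {hi F x ∨ hi G x} p
... | inj₂ q = ∨-mono (∨-introʳ (hi F x)) (∨-introʳ (hi G x)) (∂-∪ (lo F) (lo G) x q)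
... | inj₁ q = ∨-mono {hi F x} (∨-introˡ _) (∨-introˡ _) q

-- The index, the position of the added point, is kept because it selects the shift to apply.
data Cover : ∀ {n} → Fin n → Subset n → Subset n → Set where
  here  : ∀ {n} {v : Subset n} → Cover fzero (false ∷ v) (true ∷ v)
  there : ∀ {n b j} {v w : Subset n} → Cover j v w → Cover (fsuc j) (b ∷ v) (b ∷ w)

Cover-size : ∀ {n j} {x y : Subset n} → Cover j x y → ∣ y ∣ ≡ suc ∣ x ∣
Cover-size here                  = refl
Cover-size (there {b = true}  c) = cong suc (Cover-size c)
Cover-size (there {b = false} c) = Cover-size c

∂-witness : ∀ {n} (F : Indicator n) x → ∂ F x ≡ true → ∃₂ λ j y → Cover j x y × F y ≡ true
∂-witness F (true ∷ x) p with ∂-witness (hi F) x p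
... | j , y , c , q = fsuc j , true ∷ y , there c , q
∂-witness F (false ∷ x) p with ∨-elim {hi F x} p
... | inj₁ q = fzero , true ∷ x , here , q
... | inj₂ q with ∂-witness (lo F) x q
...   | j , y , c , r = fsuc j , false ∷ y , there c , r

-- Fixes the second point and keeps the first one in front, so that a shift at a deeper position
-- acts slice by slice.
slice : ∀ {n} → Bool → Indicator (suc (suc n)) → Indicator (suc n)
slice b F (a ∷ v) = F (a ∷ b ∷ v)

lev-slice-suc : ∀ {n} r (F : Indicator (suc (suc n))) →
                lev (suc r) F ≡ lev (suc r) (slice false F) + lev r (slice true F)
lev-slice-suc zero    F = trans (+-assoc a b c) (trans (cong (a +_) (+-comm b c)) (sym (+-assoc a c b)))
  where a = lev 1 (lo (lo F))
        b = lev 0 (hi (lo F))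
        c = lev 0 (lo (hi F))
lev-slice-suc (suc r) F =
  interchange (lev (2 + r) (lo (lo F))) (lev (1 + r) (hi (lo F))) (lev (1 + r) (lo (hi F))) (lev r (hi (hi F)))

lev-cong-slice : ∀ {n} {F G : Indicator (suc (suc n))} → (∀ b r → lev r (slice b F) ≡ lev r (slice b G)) →
                 ∀ r → lev r F ≡ lev r G
lev-cong-slice h zero    = h false zero
lev-cong-slice {F = F} {G} h (suc r) =
  trans (lev-slice-suc r F) (trans (cong₂ _+_ (h false (suc r)) (h true r)) (sym (lev-slice-suc r G)))

-- The shift replacing the element at position 1 + j by the one at position 0 wherever possible.
shift : ∀ {n} → Fin n → Indicator (suc n) → Indicator (suc n)
shift fzero    F (false ∷ false ∷ v) = F (false ∷ false ∷ v)
shift fzero    F (false ∷ true  ∷ v) = F (false ∷ true ∷ v) ∧ F (true ∷ false ∷ v)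
shift fzero    F (true  ∷ false ∷ v) = F (false ∷ true ∷ v) ∨ F (true ∷ false ∷ v)
shift fzero    F (true  ∷ true  ∷ v) = F (true ∷ true ∷ v)
shift (fsuc j) F (a ∷ b ∷ v)         = shift j (slice b F) (a ∷ v)

slice-shift : ∀ {n} (j : Fin n) b F → slice b (shift (fsuc j) F) ≗ shift j (slice b F)
slice-shift j b F (a ∷ v) = refl

-- The parts of trace {2} and {1} become their intersection and union while the other two stay, so
-- the modular law applies.
lev-shift : ∀ {n} (j : Fin n) F r → lev r (shift j F) ≡ lev r F
lev-shift fzero F zero = refl
lev-shift fzero F (suc zero) = trans (+-assoc (lev 1 (lo (lo F))) _ _)
  (trans (cong (lev 1 (lo (lo F)) +_) (lev-∩∪ 0 (hi (lo F)) (lo (hi F)))) (sym (+-assoc (lev 1 (lo (lo F))) _ _)))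
lev-shift fzero F (suc (suc r)) = begin
  (a + lev (suc r) (B ∩ D)) + (lev (suc r) (B ∪ D) + e) ≡⟨ regroup a (lev (suc r) (B ∩ D)) (lev (suc r) (B ∪ D)) e ⟩
  (a + e) + (lev (suc r) (B ∩ D) + lev (suc r) (B ∪ D)) ≡⟨ cong ((a + e) +_) (lev-∩∪ (suc r) B D) ⟩
  (a + e) + (lev (suc r) B + lev (suc r) D)             ≡⟨ regroup a (lev (suc r) B) (lev (suc r) D) e ⟨
  (a + lev (suc r) B) + (lev (suc r) D + e)             ∎
  where
    open ≡-Reasoning
    B = hi (lo F)
    D = lo (hi F)
    a = lev (2 + r) (lo (lo F))
    e = lev r (hi (hi F))
    regroup : ∀ a b c e → (a + b) + (c + e) ≡ (a + e) + (b + c)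
    regroup a b c e = trans (cong ((a + b) +_) (+-comm c e)) (interchange a b e c)
lev-shift {suc (suc n)} (fsuc j) F r = lev-cong-slice
  (λ b r → trans (lev-cong r (slice-shift j b F)) (lev-shift j (slice b F) r)) r

shift-mono : ∀ {n} (j : Fin n) {F G} → F ⊑ G → shift j F ⊑ shift j G
shift-mono fzero    h (false ∷ false ∷ v) p = h _ p
shift-mono fzero    h (false ∷ true  ∷ v) p = ∧-mono (h _) (h _) p
shift-mono fzero    h (true  ∷ false ∷ v) p = ∨-mono (h _) (h _) p
shift-mono fzero    h (true  ∷ true  ∷ v) p = h _ p
shift-mono (fsuc j) h (a ∷ b ∷ v)         p = shift-mono j (λ { (a ∷ v) → h (a ∷ b ∷ v) }) (a ∷ v) p

shift-∪ : ∀ {n} (j : Fin n) F G → shift j F ∪ shift j G ⊑ shift j (F ∪ G)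
shift-∪ j F G x p with ∨-elim {shift j F x} p
... | inj₁ q = shift-mono j (λ x → ∨-introˡ (G x)) x q
... | inj₂ q = shift-mono j (λ x → ∨-introʳ (F x)) x q

lo-shift : ∀ {n} (j : Fin n) F → lo (shift j F) ⊑ lo F
lo-shift fzero    F (false ∷ v) p = p
lo-shift fzero    F (true  ∷ v) p = proj₁ (∧-elim p)
lo-shift (fsuc j) F (b ∷ v)     p = lo-shift j (slice b F) v p

-- The target `true ∷ x` is vacant, so `false ∷ y`, if present, moves there and leaves `lo`.
shift-moves : ∀ {n} {j : Fin n} F {x y} → Cover j x y → hi F x ≡ false → lo (shift j F) y ≡ false
shift-moves F (here {v = v})            p rewrite p with F (false ∷ true ∷ v)
... | true  = refl
... | false = refl
shift-moves F (there {b = b} c) p = shift-moves (slice b F) c p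

∂-slice-true : ∀ {n} (F : Indicator (suc (suc n))) → slice true (∂ F) ≗ ∂ (slice true F)
∂-slice-true F (true  ∷ v) = refl
∂-slice-true F (false ∷ v) = refl

∂-slice-false : ∀ {n} (F : Indicator (suc (suc n))) → slice false (∂ F) ≗ slice true F ∪ ∂ (slice false F)
∂-slice-false F (true  ∷ v) = refl
∂-slice-false F (false ∷ v) = begin
  p ∨ q ∨ r   ≡⟨ ∨-assoc p q r ⟨
  (p ∨ q) ∨ r ≡⟨ cong (_∨ r) (∨-comm p q) ⟩
  (q ∨ p) ∨ r ≡⟨ ∨-assoc q p r ⟩
  q ∨ p ∨ r   ∎
  where
    open ≡-Reasoning
    p = F (true ∷ false ∷ v)
    q = F (false ∷ true ∷ v)
    r = ∂ (lo (lo F)) v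

-- For the first two points the four traces are checked directly. A deeper shift reduces to slices,
-- where the `false` slice of the shadow gains the `true` slice of `F`; `shift-mono` and `shift-∪`
-- handle this union.
∂-shift : ∀ {n} (j : Fin n) F → ∂ (shift j F) ⊑ shift j (∂ F)
∂-shift fzero F (true ∷ true ∷ v) p = p
∂-shift fzero F (true ∷ false ∷ v) p with ∨-elim {F (true ∷ true ∷ v)} p
... | inj₁ q = ∨-introˡ _ (∨-introˡ _ q)
... | inj₂ q = ∨-mono (∨-introʳ (F (true ∷ true ∷ v))) (∨-introʳ (F (true ∷ true ∷ v)))
                 (∂-∪ (hi (lo F)) (lo (hi F)) v q)
∂-shift fzero F (false ∷ true ∷ v) p with ∨-elim {F (true ∷ true ∷ v)} p
... | inj₁ q = ∧-intro (∨-introˡ _ q) (∨-introˡ _ q)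
... | inj₂ q = ∧-intro (∨-introʳ (F (true ∷ true ∷ v)) (∂-mono (λ x r → proj₁ (∧-elim r)) v q))
                       (∨-introʳ (F (true ∷ true ∷ v)) (∂-mono (λ x r → proj₂ (∧-elim r)) v q))
∂-shift fzero F (false ∷ false ∷ v) p with F (true ∷ false ∷ v) | F (false ∷ true ∷ v) | ∂ (lo (lo F)) v
... | true  | _     | _    = refl
... | false | true  | _    = refl
... | false | false | true = refl
∂-shift {suc (suc n)} (fsuc j) F (a ∷ true ∷ v) p =
  shift-mono j (λ x q → trans (∂-slice-true F x) q) (a ∷ v)
    (∂-shift j (slice true F) (a ∷ v)
      (∂-mono (λ x q → trans (sym (slice-shift j true F x)) q) (a ∷ v)
        (trans (sym (∂-slice-true (shift (fsuc j) F) (a ∷ v))) p)))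
∂-shift {suc (suc n)} (fsuc j) F (a ∷ false ∷ v) p =
  shift-mono j (λ x q → trans (∂-slice-false F x) q) (a ∷ v)
    (shift-∪ j (slice true F) (∂ (slice false F)) (a ∷ v)
      (∨-mono (λ q → trans (sym (slice-shift j true F (a ∷ v))) q)
        (λ q → ∂-shift j (slice false F) (a ∷ v)
                 (∂-mono (λ x r → trans (sym (slice-shift j false F x)) r) (a ∷ v) q))
        (trans (sym (∂-slice-false (shift (fsuc j) F) (a ∷ v))) p)))

-- The Kruskal–Katona theorem for cascades

-- The first `s` terms of a cascade whose upper arguments drop by two. As `r ∸ 1` sticks at 0, the
-- Kruskal-Katona statements restrict to `s ≤ suc r`, which stops at the first lower index 0.
cascade : ℕ → ℕ → ℕ → ℕ
cascade N r zero    = 0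
cascade N r (suc s) = N C r + cascade (N ∸ 2) (r ∸ 1) s

nC0≡1 : ∀ n → n C 0 ≡ 1
nC0≡1 n = trans (nCk≡nC[n∸k] {0} {n} z≤n) (nCn≡1 n)

cascade-full : ∀ N r → cascade N r (suc r) ≡ suc (cascade N r r)
cascade-full N zero    = trans (+-identityʳ _) (nC0≡1 N)
cascade-full N (suc r) = trans (cong (N C suc r +_) (cascade-full (N ∸ 2) r)) (+-suc _ _)

-- At `N = 0` Pascal's rule with `pred` fails for lower index 1, since `0 C 0` is 1. Hence an
-- equation from lower index 2 on, and only an inequality at 1.
pascal-pred : ∀ N r → N C (2 + r) ≡ pred N C (2 + r) + pred N C (1 + r)
pascal-pred zero    r = refl
pascal-pred (suc N) r = trans (sym (nCk+nC[k+1]≡[n+1]C[k+1] N (1 + r))) (+-comm (N C (1 + r)) _)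

pascal-pred-≤ : ∀ N r → N C suc r ≤ pred N C suc r + pred N C r
pascal-pred-≤ zero    r = z≤n
pascal-pred-≤ (suc N) r = ≤-reflexive (trans (sym (nCk+nC[k+1]≡[n+1]C[k+1] N r)) (+-comm (N C r) _))

pred-∸2 : ∀ N → pred (N ∸ 2) ≡ pred N ∸ 2
pred-∸2 zero                = refl
pred-∸2 (suc zero)          = refl
pred-∸2 (suc (suc zero))    = refl
pred-∸2 (suc (suc (suc N))) = refl

-- `s ≤ r` keeps every lower index on the left at least 2, where `pascal-pred` applies.
cascade-pascal : ∀ N r s → s ≤ r → cascade N (suc r) s ≡ cascade (pred N) (suc r) s + cascade (pred N) r s
cascade-pascal N r       zero    _         = refl
cascade-pascal N (suc r) (suc s) (s≤s s≤r) = trans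
  (cong₂ _+_ (pascal-pred N r) (trans (cascade-pascal (N ∸ 2) r s s≤r)
    (cong (λ M → cascade M (suc r) s + cascade M r s) (pred-∸2 N))))
  (interchange (pred N C (2 + r)) _ _ _)

cascade-pascal-≤ : ∀ N r s → s ≤ suc r →
                   cascade N (suc r) s ≤ cascade (pred N) (suc r) s + cascade (pred N) r s
cascade-pascal-≤ N r       zero          _   = z≤n
cascade-pascal-≤ N zero    (suc zero)    _   = ≤-trans (+-monoˡ-≤ 0 (pascal-pred-≤ N 0))
  (≤-reflexive (trans (+-identityʳ _) (sym (cong₂ _+_ (+-identityʳ (pred N C 1)) (+-identityʳ (pred N C 0))))))
cascade-pascal-≤ N zero    (suc (suc s)) (s≤s ())
cascade-pascal-≤ N (suc r) (suc s) (s≤s s≤r) = ≤-trans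
  (+-mono-≤ (pascal-pred-≤ N (suc r)) (≤-trans (cascade-pascal-≤ (N ∸ 2) r s s≤r)
    (≤-reflexive (cong (λ M → cascade M (suc r) s + cascade M r s) (pred-∸2 N)))))
  (≤-reflexive (interchange (pred N C (2 + r)) _ _ _))

-- Strictness fails at `s = suc r`: for `r = 0` the bound 1 is already reached by the empty set. The
-- inductive step uses the strict form on `lo F` and the weak form on `hi F`.
KKStrict KKWeak : ℕ → Set
KKStrict n = ∀ N r s → s ≤ r → (F : Indicator n) →
             cascade N (suc r) s < lev (suc r) F → cascade N r s < lev r (∂ F)
KKWeak   n = ∀ N r s → s ≤ suc r → (F : Indicator n) →
             cascade N (suc r) s < lev (suc r) F → cascade N r s ≤ lev r (∂ F)

cascade-trunc : ∀ N r → cascade N (suc r) r ≤ cascade N (suc r) (suc r)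
cascade-trunc N zero    = z≤n
cascade-trunc N (suc r) = +-monoʳ-≤ (N C (2 + r)) (cascade-trunc (N ∸ 2) r)

-- When s = r + 1 the last term of cascade N r s is C(·, 0) = 1, which the strict inequality for s = r provides.
kk-weaken : ∀ {n} → KKStrict n → KKWeak n
kk-weaken kk N r s s≤1+r F p with m≤n⇒m<n∨m≡n s≤1+r
... | inj₁ (s≤s s≤r) = <⇒≤ (kk N r s s≤r F p)
... | inj₂ refl      = ≤-trans (≤-reflexive (cascade-full N r))
                         (kk N r r ≤-refl F (≤-<-trans (cascade-trunc N r) p))

-- By Pascal's rule `lo F` or `hi F` exceeds its share. If `lo F` does, its shadow is large by
-- induction, and `comp` passes this on to `hi F`. In `∂ F` the sets avoiding the first point
-- include `hi F`, and those containing it come from `∂ (hi F)`.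
kk-compressed : ∀ {n} → KKStrict n → ∀ N r s → s ≤ r → (F : Indicator (suc n)) → lev r (∂ (lo F)) ≤ lev r (hi F) →
                cascade N (suc r) s < lev (suc r) F → cascade N r s < lev r (∂ F)
kk-compressed kk N r s s≤r F comp p = finish r s≤r hi-large
  where
    hi-large : cascade (pred N) r s < lev r (hi F)
    hi-large with <-split {cascade (pred N) (suc r) s} {cascade (pred N) r s} {lev (suc r) (lo F)}
                    (subst (_< _) (cascade-pascal N r s s≤r) p)
    ... | inj₁ q = <-≤-trans (kk (pred N) r s s≤r (lo F) q) comp
    ... | inj₂ q = q

    finish : ∀ r → s ≤ r → cascade (pred N) r s < lev r (hi F) → cascade N r s < lev r (∂ F)
    -- Here `s` is 0 and both cascades vanish.
    finish zero     z≤n   q = <-≤-trans q (lev-∪ˡ 0 (hi F) (∂ (lo F)))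
    finish (suc r′) s≤1+r q = ≤-<-trans (cascade-pascal-≤ N r′ s s≤1+r)
      (+-mono-<-≤ (<-≤-trans q (lev-∪ˡ (suc r′) (hi F) (∂ (lo F))))
                  (kk-weaken kk (pred N) r′ s s≤1+r (hi F) q))

-- Induction on `n`, with an inner induction on the number of `suc r`-sets of `F` avoiding the first
-- point.
kk-strict : ∀ n → KKStrict n
kk-strict zero    N r s s≤r F ()
kk-strict (suc n) N r s s≤r F = go F (<-wellFounded _)
  where
    go : ∀ F → Acc _<_ (lev (suc r) (lo F)) → cascade N (suc r) s < lev (suc r) F → cascade N r s < lev r (∂ F)
    go F (acc rec) p with lev r (∂ (lo F)) ≤? lev r (hi F)
    ... | yes comp = kk-compressed (kk-strict n) N r s s≤r F comp p
    -- Some `x` in the shadow of `lo F` is missing from `hi F`. Adding a point `j` gives `y` in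
    -- `lo F`; the shift at `j` removes it from `lo`, which lowers the measure.
    ... | no ¬comp with lev-<-witness r (hi F) (∂ (lo F)) (≰⇒> ¬comp)
    ... | x , size , x∉ , x∈∂ with ∂-witness (lo F) x x∈∂
    ... | j , y , c , y∈ = <-≤-trans
      (go (shift j F)
          (rec (lev-strict (suc r) (lo (shift j F)) (lo F) (lo-shift j F) y
                 (trans (Cover-size c) (cong suc size)) (shift-moves F c x∉) y∈))
          (subst (cascade N (suc r) s <_) (sym (lev-shift j F (suc r))) p))
      (≤-trans (lev-mono r (λ x _ → ∂-shift j F x)) (≤-reflexive (lev-shift j (∂ F) r)))

kk : ∀ n → KKWeak n
kk n = kk-weaken (kk-strict n)

-- Profiles of families

pascal : ∀ n r → suc n C suc r ≡ n C suc r + n C r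
pascal n r = trans (sym (nCk+nC[k+1]≡[n+1]C[k+1] n r)) (+-comm (n C r) _)

lev-∁ : ∀ {n} r (F : Indicator n) → lev r F + lev r (∁ F) ≡ n C r
lev-∁ {zero}  zero    F with F []
... | true  = refl
... | false = refl
lev-∁ {zero}  (suc r) F = refl
lev-∁ {suc n} zero    F = trans (lev-∁ zero (lo F)) (trans (nC0≡1 n) (sym (nC0≡1 (suc n))))
lev-∁ {suc n} (suc r) F = trans
  (interchange (lev (suc r) (lo F)) (lev r (hi F)) (lev (suc r) (lo (∁ F))) (lev r (hi (∁ F))))
  (trans (cong₂ _+_ (lev-∁ (suc r) (lo F)) (lev-∁ r (hi F))) (sym (pascal n r)))

lev-none : ∀ {n} r (F : Indicator n) → (∀ x → ∣ x ∣ ≡ r → F x ≡ false) → lev r F ≡ 0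
lev-none {zero}  zero    F h rewrite h [] refl = refl
lev-none {zero}  (suc r) F h = refl
lev-none {suc n} zero    F h = lev-none zero (lo F) (λ x → h (false ∷ x))
lev-none {suc n} (suc r) F h = cong₂ _+_ (lev-none (suc r) (lo F) (λ x → h (false ∷ x)))
                                         (lev-none r (hi F) (λ x e → h (true ∷ x) (cong suc e)))

∅ : ∀ {n} → Indicator n
∅ _ = false

lev-∅ : ∀ {n} r → lev r (∅ {n}) ≡ 0
lev-∅ {n} r = lev-none r (∅ {n}) (λ _ _ → refl)

lev≡0⇒∉ : ∀ {n} (F : Indicator n) x {r} → ∣ x ∣ ≡ r → lev r F ≡ 0 → F x ≢ true
lev≡0⇒∉ {n} F x {r} e l p with subst (lev r (∅ {n}) <_) l (lev-strict r ∅ F (λ _ ()) x e refl p)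
... | ()

ofSize : ∀ {n} → ℕ → Indicator n
ofSize m x = does (∣ x ∣ ≟ m)

lev-ofSize : ∀ {n} m → lev m (ofSize {n} m) ≡ n C m
lev-ofSize {n} m = trans (sym (+-identityʳ _)) (trans
  (cong (lev m (ofSize {n} m) +_) (sym (lev-none m (∁ (ofSize {n} m)) (λ x e → cong not (dec-true (∣ x ∣ ≟ m) e)))))
  (lev-∁ m (ofSize {n} m)))

lev-ofSize-≢ : ∀ {n} r m → r ≢ m → lev r (ofSize {n} m) ≡ 0
lev-ofSize-≢ {n} r m r≢m = lev-none r (ofSize {n} m) (λ x e → dec-false (∣ x ∣ ≟ m) (r≢m ∘ trans (sym e)))

_≟ˢ_ : ∀ {n} (x y : Subset n) → Dec (x ≡ y)
_≟ˢ_ = ≡-dec Bool._≟_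

module _ {n : ℕ} where
  open import Data.List.Membership.DecPropositional (_≟ˢ_ {n}) using (_∈?_) public

mem : ∀ {n} → Family n → Indicator n
mem 𝒞 x = does (x ∈? 𝒞)

mem⁻ : ∀ {n} {𝒞 : Family n} {x} → mem 𝒞 x ≡ true → x ∈ 𝒞
mem⁻ {𝒞 = 𝒞} {x} p with x ∈? 𝒞
... | yes q = q

lev-singleton : ∀ {n} (A : Subset n) → lev (∣_∣ A) (λ x → does (x ≟ˢ A)) ≡ 1
lev-singleton []          = refl
lev-singleton {suc n} (true ∷ A) = cong₂ _+_ (lev-∅ {n} (suc ∣ A ∣)) (lev-singleton A)
lev-singleton {suc n} (false ∷ A) with ∣ A ∣ | lev-singleton A
... | zero  | p = p
... | suc r | p = cong₂ _+_ p (lev-∅ {n} r)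

-- Uniqueness makes the head disjoint from the tail, so by the modular law it adds exactly one to
-- its own level.
fvec≡lev : ∀ {n} {𝒞 : Family n} → Unique 𝒞 → ∀ i → fvec 𝒞 i ≡ lev i (mem 𝒞)
fvec≡lev {n} [] i = sym (lev-∅ {n} i)
fvec≡lev {n} {A ∷ 𝒞} (A∉ ∷ u) i = sym (trans (sym (cong (_+ lev i (mem (A ∷ 𝒞))) disjoint))
    (trans (lev-∩∪ i A? (mem 𝒞)) (trans (cong (lev i A? +_) (sym (fvec≡lev u i))) count)))
  where
    A? : Indicator n
    A? x = does (x ≟ˢ A)
    disjoint : lev i (A? ∩ mem 𝒞) ≡ 0
    disjoint = lev-none i (A? ∩ mem 𝒞) λ x _ → ¬-not λ p → apart x (∧-elim p)
      where
        apart : ∀ x → ¬ (A? x ≡ true × mem 𝒞 x ≡ true)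
        apart x (p , q) with x ≟ˢ A
        ... | yes refl = lookup A∉ (mem⁻ {𝒞 = 𝒞} q) refl
    count : lev i A? + fvec 𝒞 i ≡ fvec (A ∷ 𝒞) i
    count with ∣ A ∣ ≟ i
    ... | yes refl = trans (cong (_+ fvec 𝒞 i) (lev-singleton A))
                           (sym (cong length (filter-accept (λ B → ∣ B ∣ ≟ i) {x = A} {xs = 𝒞} refl)))
    ... | no ¬e    = trans (cong (_+ fvec 𝒞 i) (lev-none i A? λ x e → dec-false (x ≟ˢ A) λ { refl → ¬e e }))
                           (sym (cong length (filter-reject (λ B → ∣ B ∣ ≟ i) {x = A} {xs = 𝒞} ¬e)))

allSubsets : ∀ n → Family n
allSubsets zero    = [] ∷ []
allSubsets (suc n) = map (false ∷_) (allSubsets n) ++ map (true ∷_) (allSubsets n)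

∈-allSubsets : ∀ {n} (x : Subset n) → x ∈ allSubsets n
∈-allSubsets []          = here refl
∈-allSubsets (false ∷ x) = ∈-++⁺ˡ (∈-map⁺ (false ∷_) (∈-allSubsets x))
∈-allSubsets {suc n} (true  ∷ x) = ∈-++⁺ʳ (map (false ∷_) (allSubsets n)) (∈-map⁺ (true ∷_) (∈-allSubsets x))

allSubsets-unique : ∀ n → Unique (allSubsets n)
allSubsets-unique zero    = All.[] ∷ []
allSubsets-unique (suc n) =
  ++⁺ (map⁺ ∷-injectiveʳ (allSubsets-unique n)) (map⁺ ∷-injectiveʳ (allSubsets-unique n)) apart
  where
    apart : ∀ {x} → ¬ (x ∈ map (false ∷_) (allSubsets n) × x ∈ map (true ∷_) (allSubsets n))
    apart (p , q) with ∈-map⁻ (false ∷_) p | ∈-map⁻ (true ∷_) q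
    ... | _ , _ , refl | _ , _ , ()

IsCutsetᵇ : ∀ {n} → Indicator n → Set
IsCutsetᵇ {n} F = ∀ (c : MaximalChain n) → ∃ λ i → F (MaximalChain.set c i) ≡ true

HasProfileᵇ : ∀ {n} → ℕ → ℕ → ℕ → Indicator n → Set
HasProfileᵇ m l k F = ∀ i → (m ≤ i → i ≤ l → lev i F ≡ k) × (i < m ⊎ l < i → lev i F ≡ 0)

-- Filtering a duplicate-free list of all subsets realises any indicator, so both bounds can be
-- proved for indicators.
attained⁺ : ∀ {n m l k} (F : Indicator n) → IsCutsetᵇ F → HasProfileᵇ m l k F → Attained n m l k
attained⁺ {n} F cut prof = 𝒞 , unique , cut′ , λ i →
    (λ p q → trans (fvec≡lev′ i) (proj₁ (prof i) p q)) , (λ p → trans (fvec≡lev′ i) (proj₂ (prof i) p))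
  where
    F? : ∀ x → Dec (F x ≡ true)
    F? x = F x Bool.≟ true
    𝒞 = filter F? (allSubsets n)
    unique = filter⁺ F? (allSubsets-unique n)
    F⇒∈ : ∀ {x} → F x ≡ true → x ∈ 𝒞
    F⇒∈ {x} = ∈-filter⁺ F? (∈-allSubsets x)
    cut′ : IsCutset 𝒞
    cut′ c with cut c
    ... | i , p = i , F⇒∈ p
    mem≗F : mem 𝒞 ≗ F
    mem≗F x with F x Bool.≟ true
    ... | yes p = trans (dec-true (x ∈? 𝒞) (F⇒∈ p)) (sym p)
    ... | no ¬p = trans (dec-false (x ∈? 𝒞) (¬p ∘ proj₂ ∘ ∈-filter⁻ F? {xs = allSubsets n}))
                        (sym (¬-not ¬p))
    fvec≡lev′ : ∀ i → fvec 𝒞 i ≡ lev i F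
    fvec≡lev′ i = trans (fvec≡lev unique i) (lev-cong i mem≗F)

attained⁻ : ∀ {n m l k} → Attained n m l k → ∃ λ (F : Indicator n) → IsCutsetᵇ F × HasProfileᵇ m l k F
attained⁻ (𝒞 , u , cut , prof) = mem 𝒞 ,
  (λ c → proj₁ (cut c) , dec-true (_ ∈? 𝒞) (proj₂ (cut c))) ,
  (λ i → (λ p q → trans (sym (fvec≡lev u i)) (proj₁ (prof i) p q)) ,
         (λ p → trans (sym (fvec≡lev u i)) (proj₂ (prof i) p)))

-- Maximal chains through a given path

_⋖_ : ∀ {n} → Subset n → Subset n → Set
x ⋖ y = ∃ λ j → Cover j x y

⋖-size : ∀ {n} {x y : Subset n} → x ⋖ y → ∣ y ∣ ≡ suc ∣ x ∣
⋖-size (_ , c) = Cover-size c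

⋖⇒⊆ : ∀ {n} {x y : Subset n} → x ⋖ y → x ⊆ y
⋖⇒⊆ (_ , here)    = out⊆ ⊆-refl
⋖⇒⊆ (_ , there c) = s⊆s (⋖⇒⊆ (_ , c))

Path : ∀ {n} → Subset n → Subset n → Set
Path = Star _⋖_

∷-path : ∀ {n} {x y : Subset n} b → Path x y → Path (b ∷ x) (b ∷ y)
∷-path b = gmap (b ∷_) (λ (j , c) → fsuc j , there c)

path-from-⊥ : ∀ {n} (x : Subset n) → Path ⊥ x
path-from-⊥ []          = ε
path-from-⊥ (false ∷ x) = ∷-path false (path-from-⊥ x)
path-from-⊥ (true  ∷ x) = (fzero , here) ◅ ∷-path true (path-from-⊥ x)

path-to-⊤ : ∀ {n} (x : Subset n) → Path x ⊤
path-to-⊤ []          = ε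
path-to-⊤ (false ∷ x) = (fzero , here) ◅ ∷-path true (path-to-⊤ x)
path-to-⊤ (true  ∷ x) = ∷-path true (path-to-⊤ x)

-- Past its end a path stays at its last vertex, which makes `nth` total; `nth-size` holds up to the
-- end only.
nth : ∀ {n} {x y : Subset n} → Path x y → ℕ → Subset n
nth {x = x} ε       i       = x
nth {x = x} (c ◅ p) zero    = x
nth         (c ◅ p) (suc i) = nth p i

nth-zero : ∀ {n} {x y : Subset n} (p : Path x y) → nth p 0 ≡ x
nth-zero ε       = refl
nth-zero (c ◅ p) = refl

nth-size : ∀ {n} {x y : Subset n} (p : Path x y) i → ∣ x ∣ + i ≤ ∣ y ∣ → ∣ nth p i ∣ ≡ ∣ x ∣ + i
nth-size {x = x} p zero    h = trans (cong ∣_∣ (nth-zero p)) (sym (+-identityʳ _))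
nth-size {x = x} ε (suc i) h = ⊥-elim (m+1+n≰m (∣_∣ x) h)
nth-size {x = x} (c ◅ p) (suc i) h = trans (nth-size p i (≤-trans (≤-reflexive e) h)) e
  where e = trans (cong (_+ i) (⋖-size c)) (sym (+-suc ∣ x ∣ i))

nth-⊆ : ∀ {n} {x y : Subset n} (p : Path x y) i → nth p i ⊆ nth p (suc i)
nth-⊆ ε       i       = ⊆-refl
nth-⊆ (c ◅ p) zero    = subst (_ ⊆_) (sym (nth-zero p)) (⋖⇒⊆ c)
nth-⊆ (c ◅ p) (suc i) = nth-⊆ p i

path-size-≤ : ∀ {n} {x y : Subset n} → Path x y → ∣ x ∣ ≤ ∣ y ∣
path-size-≤ ε       = ≤-refl
path-size-≤ (c ◅ p) = ≤-trans (≤-trans (n≤1+n _) (≤-reflexive (sym (⋖-size c)))) (path-size-≤ p)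

nth-size-≥ : ∀ {n} {x y : Subset n} (p : Path x y) i → ∣ x ∣ ≤ ∣ nth p i ∣
nth-size-≥ ε       i       = ≤-refl
nth-size-≥ (c ◅ p) zero    = ≤-refl
nth-size-≥ (c ◅ p) (suc i) = ≤-trans (≤-trans (n≤1+n _) (≤-reflexive (sym (⋖-size c)))) (nth-size-≥ p i)

-- A vertex before `q` is strictly smaller than `y`. With the mirror image `nth-◅◅ˡ`, a vertex of an
-- extended path lies on the middle part or has a size outside its range.
nth-◅◅ʳ : ∀ {n} {x y z : Subset n} (p : Path x y) (q : Path y z) i →
          (∃ λ k → nth (p ◅◅ q) i ≡ nth q k) ⊎ ∣ nth (p ◅◅ q) i ∣ < ∣ y ∣
nth-◅◅ʳ ε       q i       = inj₁ (i , refl)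
nth-◅◅ʳ (c ◅ p) q zero    = inj₂ (≤-trans (≤-reflexive (sym (⋖-size c))) (path-size-≤ p))
nth-◅◅ʳ (c ◅ p) q (suc i) = nth-◅◅ʳ p q i

nth-◅◅ˡ : ∀ {n} {x y z : Subset n} (p : Path x y) (q : Path y z) i →
          (∃ λ k → nth (p ◅◅ q) i ≡ nth p k) ⊎ ∣ y ∣ < ∣ nth (p ◅◅ q) i ∣
nth-◅◅ˡ ε       q       zero    = inj₁ (0 , nth-zero q)
nth-◅◅ˡ ε       ε       (suc i) = inj₁ (0 , refl)
nth-◅◅ˡ ε       (c ◅ q) (suc i) = inj₂ (≤-trans (≤-reflexive (sym (⋖-size c))) (nth-size-≥ q i))
nth-◅◅ˡ (c ◅ p) q       zero    = inj₁ (0 , refl)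
nth-◅◅ˡ (c ◅ p) q       (suc i) with nth-◅◅ˡ p q i
... | inj₁ (k , e) = inj₁ (suc k , e)
... | inj₂ lt      = inj₂ lt

path⇒chain : ∀ {n} → Path {n} ⊥ ⊤ → MaximalChain n
path⇒chain {n} p = record
  { set  = nth p ∘ toℕ
  ; size = λ i → trans
      (nth-size p (toℕ i)
        (subst₂ _≤_ (sym (cong (_+ toℕ i) (∣⊥∣≡0 n))) (sym (∣⊤∣≡n n)) (≤-pred (toℕ<n i))))
      (cong (_+ toℕ i) (∣⊥∣≡0 n))
  ; incl = λ i → subst (λ k → nth p k ⊆ nth p (suc (toℕ i))) (sym (toℕ-inject₁ i)) (nth-⊆ p (toℕ i))
  }

-- The path extends to a maximal chain. A member of `F` on that chain cannot lie below level `m` or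
-- above level `l`, where `F` is empty, so it lies on the path.
cutset-meets : ∀ {n m l k} {F : Indicator n} → IsCutsetᵇ F → HasProfileᵇ m l k F →
               ∀ {x y} → ∣ x ∣ ≡ m → ∣ y ∣ ≡ l → (p : Path x y) → ∃ λ k → F (nth p k) ≡ true
cutset-meets {F = F} cut prof {x} {y} refl refl p
  with cut (path⇒chain (path-from-⊥ x ◅◅ (p ◅◅ path-to-⊤ y)))
... | i , F∋ with nth-◅◅ʳ (path-from-⊥ x) (p ◅◅ path-to-⊤ y) (toℕ i)
... | inj₂ lt = ⊥-elim (lev≡0⇒∉ F _ refl (proj₂ (prof _) (inj₁ lt)) F∋)
... | inj₁ (j , e) with nth-◅◅ˡ p (path-to-⊤ y) j | subst (λ z → F z ≡ true) e F∋
...   | inj₂ lt       | F∋′ = ⊥-elim (lev≡0⇒∉ F _ refl (proj₂ (prof _) (inj₂ lt)) F∋′)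
...   | inj₁ (k , e′) | F∋′ = k , subst (λ z → F z ≡ true) e′ F∋′

-- Binomial identities for cascades

sum-applyUpTo≡cascade : ∀ n m s (f : ℕ → ℕ) → (∀ j → f j ≡ (n ∸ (2 * j + 2)) C (m ∸ j)) →
                        sum (applyUpTo f s) ≡ cascade (n ∸ 2) m s
sum-applyUpTo≡cascade n m zero    f h = refl
-- The tail is a sum of the same form for `f ∘ suc`, with `n` lowered by 2 and `m` by 1; this is why
-- `f` is abstract.
sum-applyUpTo≡cascade n m (suc s) f h = cong₂ _+_ (h 0)
  (sum-applyUpTo≡cascade (n ∸ 2) (m ∸ 1) s (f ∘ suc) λ j → trans (h (suc j)) (cong₂ _C_
    (trans (cong (n ∸_) (2*[1+j]+2 j)) (sym (∸-+-assoc n 2 (2 * j + 2))))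
    (sym (∸-+-assoc m 1 j))))
  where
    2*[1+j]+2 : ∀ j → 2 * suc j + 2 ≡ 2 + (2 * j + 2)
    2*[1+j]+2 = solve-∀

sum3≡cascade : ∀ n m → sum3 n m ≡ cascade (n ∸ 2) m (suc m)
sum3≡cascade n m = trans (cong sum (map-upTo (λ j → (n ∸ (2 * j + 2)) C (m ∸ j)) (suc m)))
                         (sum-applyUpTo≡cascade n m (suc m) _ (λ _ → refl))

2s≤n⇒n≥2 : ∀ {n s} → suc s + suc s ≤ n → ∃ λ n′ → n ≡ 2 + n′ × s + s ≤ n′
2s≤n⇒n≥2 {suc zero}    {s} (s≤s h) with ≤-trans (≤-reflexive (sym (+-suc s s))) h
... | ()
2s≤n⇒n≥2 {suc (suc n)} {s} (s≤s h) = n , refl , ≤-pred (≤-trans (≤-reflexive (sym (+-suc s s))) h)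

1+m+1+m≡2m+2 : ∀ m → suc m + suc m ≡ 2 * m + 2
1+m+1+m≡2m+2 = solve-∀

-- Two Pascal steps give C(n, m+2) = C(n-1, m+2) + C(n-2, m+1) + C(n-2, m). The outer terms are the
-- heads of the two cascades, and the middle one bounds the tails by induction.
cascade-complement : ∀ n m s → s ≤ suc m → s + s ≤ n →
                     cascade (n ∸ 2) m s + cascade (n ∸ 1) (2 + m) s ≤ n C (2 + m)
cascade-complement n m zero    _         _    = z≤n
cascade-complement n m (suc s) (s≤s s≤m) 2s≤n with 2s≤n⇒n≥2 {n} 2s≤n
... | n′ , refl , h = begin
  (n′ C m + a) + (suc n′ C (2 + m) + b) ≡⟨ regroup (n′ C m) a (suc n′ C (2 + m)) b ⟩
  suc n′ C (2 + m) + ((a + b) + n′ C m) ≤⟨ +-monoʳ-≤ (suc n′ C (2 + m)) (+-monoˡ-≤ (n′ C m) (rest m s s≤m h)) ⟩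
  suc n′ C (2 + m) + (n′ C suc m + n′ C m) ≡⟨ cong (suc n′ C (2 + m) +_) (pascal n′ m) ⟨
  suc n′ C (2 + m) + suc n′ C (1 + m) ≡⟨ pascal (suc n′) (1 + m) ⟨
  (2 + n′) C (2 + m) ∎
  where
    open ≤-Reasoning
    a = cascade (n′ ∸ 2) (m ∸ 1) s
    b = cascade (n′ ∸ 1) (1 + m) s
    regroup : ∀ x a y b → (x + a) + (y + b) ≡ y + ((a + b) + x)
    regroup = solve-∀
    rest : ∀ m s → s ≤ m → s + s ≤ n′ → cascade (n′ ∸ 2) (m ∸ 1) s + cascade (n′ ∸ 1) (1 + m) s ≤ n′ C suc m
    rest m        zero    _   _ = z≤n
    rest (suc m′) (suc s) s≤m h = cascade-complement n′ m′ (suc s) s≤m h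

-- `s + s ≤ suc N` keeps every upper argument positive, so Pascal's rule is exact even at lower
-- index 1. The lower bound for three levels needs the direction opposite to `cascade-pascal-≤`.
cascade-pascal-large : ∀ N r s → s ≤ suc r → s + s ≤ suc N →
                       cascade N (suc r) s ≡ cascade (pred N) (suc r) s + cascade (pred N) r s
cascade-pascal-large N r zero    _         _ = refl
cascade-pascal-large N r (suc s) (s≤s s≤r) h with 2s≤n⇒n≥2 h
cascade-pascal-large (suc N) r (suc s) (s≤s s≤r) _ | .N , refl , h = trans
  (cong₂ _+_ (pascal N r) (rest r s s≤r h))
  (interchange (N C suc r) (N C r) _ _)
  where
    rest : ∀ r s → s ≤ r → s + s ≤ N → cascade (N ∸ 1) r s ≡ cascade (N ∸ 2) r s + cascade (N ∸ 2) (r ∸ 1) s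
    rest r        zero    _   _ = refl
    rest (suc r′) (suc s) s≤r h =
      trans (cascade-pascal-large (N ∸ 1) r′ (suc s) s≤r (≤-trans h (m≤n+m∸n N 1)))
        (cong (λ M → cascade M (suc r′) (suc s) + cascade M r′ (suc s)) (pred[m∸n]≡m∸[1+n] N 1))

-- Lower bounds

lev-∁-shadow : ∀ {n} N r s (F : Indicator n) → s ≤ suc r → cascade N (suc r) s + lev (suc r) F < n C suc r →
               cascade N r s ≤ lev r (∂ (∁ F))
lev-∁-shadow {n} N r s F s≤1+r h = kk n N r s s≤1+r (∁ F)
  (+-cancelʳ-< (lev (suc r) F) (cascade N (suc r) s) (lev (suc r) (∁ F))
    (subst (cascade N (suc r) s + lev (suc r) F <_)
      (trans (sym (lev-∁ (suc r) F)) (+-comm (lev (suc r) F) _)) h))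

∁-disjoint : ∀ {b} → b ≡ true → not b ≢ true
∁-disjoint refl ()

lower₁ : ∀ {n m k} → Attained n m m k → n C m ≤ k
lower₁ {n} {m} {k} att with attained⁻ att
... | F , cut , prof = begin
  n C m           ≡⟨ lev-ofSize {n} m ⟨
  -- A one-vertex path must be met at that vertex.
  lev m (ofSize {n} m) ≤⟨ lev-mono m {ofSize m} {F} (λ x e _ → proj₂ (cutset-meets cut prof e e (ε {x = x}))) ⟩
  lev m F         ≡⟨ proj₁ (prof m) ≤-refl ≤-refl ⟩
  k               ∎
  where open ≤-Reasoning

-- If `k` were smaller, more than `n C suc m` top sets would be missing, and their shadow, which
-- lies in `F`, would have at least `n C m` sets.
lower₂ : ∀ {n m k} → Attained (suc n) m (suc m) k → n C m ≤ k
lower₂ {n} {m} {k} att with attained⁻ att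
... | F , cut , prof with n C m ≤? k
...   | yes p = p
...   | no ¬p = begin
  n C m               ≡⟨ +-identityʳ _ ⟨
  cascade n m 1       ≤⟨ lev-∁-shadow n m 1 F (s≤s z≤n) few ⟩
  lev m (∂ (∁ F))     ≤⟨ lev-mono m shadow ⟩
  lev m F             ≡⟨ proj₁ (prof m) ≤-refl (n≤1+n m) ⟩
  k                   ∎
  where
    open ≤-Reasoning
    few : cascade n (suc m) 1 + lev (suc m) F < suc n C suc m
    few = begin-strict
      cascade n (suc m) 1 + lev (suc m) F ≡⟨ cong₂ _+_ (+-identityʳ _) (proj₁ (prof (suc m)) (n≤1+n m) ≤-refl) ⟩
      n C suc m + k                       <⟨ +-monoʳ-< (n C suc m) (≰⇒> ¬p) ⟩
      n C suc m + n C m                   ≡⟨ pascal n m ⟨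
      suc n C suc m                       ∎
    shadow : ∀ x → ∣ x ∣ ≡ m → ∂ (∁ F) x ≡ true → F x ≡ true
    shadow x e p with ∂-witness (∁ F) x p
    ... | j , y , c , y∉ with cutset-meets cut prof e (trans (Cover-size c) (cong suc e)) ((j , c) ◅ ε)
    ...   | zero  , q = q
    ...   | suc _ , q = ⊥-elim (∁-disjoint q y∉)

-- If `k` is below the bound, the shadow of the missing top sets has at least
-- `cascade (n ∸ 1) (suc m) (suc m)` members. Pascal splits this into
-- `cascade (n ∸ 2) (suc m) (suc m)` and the bound itself. Fewer than the bound lie in `F`, so `D`
-- exceeds the first part and its shadow reaches the bound.
lower₃ : ∀ {n m k} → 2 * m + 2 ≤ n → Attained n m (2 + m) k → sum3 n m ≤ k
lower₃ {n} {m} {k} 2m+2≤n att with attained⁻ att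
... | F , cut , prof with sum3 n m ≤? k
...   | yes p = p
...   | no ¬p = begin
  sum3 n m                ≡⟨ sum3≡cascade n m ⟩
  cascade (n ∸ 2) m (suc m) ≤⟨ kk n (n ∸ 2) m (suc m) ≤-refl D D-large ⟩
  lev m (∂ D)             ≤⟨ lev-mono m shadow ⟩
  lev m F                 ≡⟨ proj₁ (prof m) ≤-refl (m≤n+m m 2) ⟩
  k                       ∎
  where
    open ≤-Reasoning
    D : Indicator n
    D = ∂ (∁ F) ∩ ∁ F
    2s≤n : suc m + suc m ≤ n
    2s≤n = ≤-trans (≤-reflexive (1+m+1+m≡2m+2 m)) 2m+2≤n
    k<c : k < cascade (n ∸ 2) m (suc m)
    k<c = <-≤-trans (≰⇒> ¬p) (≤-reflexive (sum3≡cascade n m))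
    few : cascade (n ∸ 1) (2 + m) (suc m) + lev (2 + m) F < n C (2 + m)
    few = begin-strict
      cascade (n ∸ 1) (2 + m) (suc m) + lev (2 + m) F
        ≡⟨ cong (cascade (n ∸ 1) (2 + m) (suc m) +_) (proj₁ (prof (2 + m)) (m≤n+m m 2) ≤-refl) ⟩
      cascade (n ∸ 1) (2 + m) (suc m) + k
        <⟨ +-monoʳ-< _ k<c ⟩
      cascade (n ∸ 1) (2 + m) (suc m) + cascade (n ∸ 2) m (suc m)
        ≡⟨ +-comm (cascade (n ∸ 1) (2 + m) (suc m)) _ ⟩
      cascade (n ∸ 2) m (suc m) + cascade (n ∸ 1) (2 + m) (suc m)
        ≤⟨ cascade-complement n m (suc m) ≤-refl 2s≤n ⟩
      n C (2 + m) ∎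
    ∂∁F≤D∪F : lev (suc m) (∂ (∁ F)) ≤ lev (suc m) D + k
    ∂∁F≤D∪F = begin
      lev (suc m) (∂ (∁ F))         ≤⟨ lev-mono (suc m) split ⟩
      lev (suc m) (D ∪ F)           ≤⟨ lev-∪-≤ (suc m) D F ⟩
      lev (suc m) D + lev (suc m) F ≡⟨ cong (lev (suc m) D +_) (proj₁ (prof (suc m)) (n≤1+n m) (n≤1+n (suc m))) ⟩
      lev (suc m) D + k             ∎
      where
        split : ∀ x → ∣ x ∣ ≡ suc m → ∂ (∁ F) x ≡ true → (D ∪ F) x ≡ true
        split x _ p with F x
        ... | true  = ∨-introʳ (∂ (∁ F) x ∧ false) refl
        ... | false = ∨-introˡ false (∧-intro p refl)
    D-large : cascade (n ∸ 2) (suc m) (suc m) < lev (suc m) D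
    D-large = +-cancelʳ-< k _ _ (begin-strict
      cascade (n ∸ 2) (suc m) (suc m) + k
        <⟨ +-monoʳ-< _ k<c ⟩
      cascade (n ∸ 2) (suc m) (suc m) + cascade (n ∸ 2) m (suc m)
        ≡⟨ cong (λ M → cascade M (suc m) (suc m) + cascade M m (suc m)) (pred[n∸1] n) ⟨
      cascade (pred (n ∸ 1)) (suc m) (suc m) + cascade (pred (n ∸ 1)) m (suc m)
        ≡⟨ cascade-pascal-large (n ∸ 1) m (suc m) ≤-refl (≤-trans 2s≤n (m≤n+m∸n n 1)) ⟨
      cascade (n ∸ 1) (suc m) (suc m)
        ≤⟨ lev-∁-shadow (n ∸ 1) (suc m) (suc m) F (n≤1+n _) few ⟩
      lev (suc m) (∂ (∁ F))
        ≤⟨ ∂∁F≤D∪F ⟩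
      lev (suc m) D + k ∎)
      where
        pred[n∸1] : ∀ n → pred (n ∸ 1) ≡ n ∸ 2
        pred[n∸1] n = pred[m∸n]≡m∸[1+n] n 1
    shadow : ∀ x → ∣ x ∣ ≡ m → ∂ D x ≡ true → F x ≡ true
    shadow x e p with ∂-witness D x p
    ... | j , y , c , y∈D with ∧-elim {∂ (∁ F) y} y∈D
    ... | y∈∂ , y∉ with ∂-witness (∁ F) y y∈∂
    -- As `y` and `z` lie outside `F`, the path can only be met at `x`.
    ... | i , z , c′ , z∉ with cutset-meets cut prof e
            (trans (Cover-size c′) (cong suc (trans (Cover-size c) (cong suc e)))) ((j , c) ◅ (i , c′) ◅ ε)
    ...   | zero        , q = q
    ...   | suc zero    , q = ⊥-elim (∁-disjoint q y∉)
    ...   | suc (suc _) , q = ⊥-elim (∁-disjoint q z∉)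

-- Upper bounds

ofSize⁺ : ∀ {n m} (x : Subset n) → ∣ x ∣ ≡ m → ofSize m x ≡ true
ofSize⁺ x e = dec-true (∣ x ∣ ≟ _) e

ofSize⁻ : ∀ {n m} (x : Subset n) → ofSize m x ≡ true → ∣ x ∣ ≡ m
ofSize⁻ {m = m} x p = ≡ᵇ⇒≡ (∣_∣ x) m (subst T (sym p) tt)

module _ {n} (c : MaximalChain n) where
  open MaximalChain c

  at-level : ∀ {i} → i ≤ n → ∃ λ j → ∣ set j ∣ ≡ i × toℕ j ≡ i
  at-level i≤n = fromℕ< (s≤s i≤n) , trans (size _) (toℕ-fromℕ< _) , toℕ-fromℕ< _

  step-⊆ : ∀ {k i j} → toℕ i ≡ k → toℕ j ≡ suc k → set i ⊆ set j
  step-⊆ {i = i} {fsuc j} refl e = subst (λ i → set i ⊆ set (fsuc j))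
    (toℕ-injective (trans (toℕ-inject₁ j) (suc-injective e))) (incl j)

upper₁ : ∀ {n m} → m ≤ n → Attained n m m (n C m)
upper₁ {n} {m} m≤n = attained⁺ (ofSize {n} m) cut prof
  where
    cut : IsCutsetᵇ (ofSize {n} m)
    cut c with at-level c m≤n
    ... | i , e , _ = i , ofSize⁺ (MaximalChain.set c i) e
    prof : HasProfileᵇ m m (n C m) (ofSize {n} m)
    prof i = (λ p q → subst (λ i → lev i (ofSize {n} m) ≡ n C m) (≤-antisym p q) (lev-ofSize {n} m)) ,
      [ lev-ofSize-≢ {n} i m ∘ <⇒≢ , lev-ofSize-≢ {n} i m ∘ >⇒≢ ]′

⊆-true : ∀ {n b} {x y : Subset n} → true ∷ x ⊆ b ∷ y → b ≡ true
⊆-true h with h here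
... | here = refl

tailFam : ∀ {n} → ℕ → Indicator (suc n)
tailFam m (_ ∷ v) = ofSize m v

-- If the `m`-set of a chain avoids the first point, it is in the family; otherwise the `suc m`-set
-- also contains that point and has `m` others.
upper₂ : ∀ {n m} → m ≤ n → Attained (suc n) m (suc m) (n C m)
upper₂ {n} {m} m≤n = attained⁺ (tailFam m) cut prof
  where
    meets : ∀ x y → ∣ x ∣ ≡ m → ∣ y ∣ ≡ suc m → x ⊆ y → tailFam {n} m x ≡ true ⊎ tailFam {n} m y ≡ true
    meets (false ∷ v) y           e e′ h = inj₁ (ofSize⁺ v e)
    meets (true  ∷ v) (b ∷ w) e e′ h with ⊆-true h
    ... | refl = inj₂ (ofSize⁺ w (suc-injective e′))
    cut : IsCutsetᵇ (tailFam m)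
    cut c with at-level c (≤-trans m≤n (n≤1+n n)) | at-level c (s≤s m≤n)
    ... | i , e , t | j , e′ , t′ with meets _ _ e e′ (step-⊆ c t t′)
    ...   | inj₁ p = i , p
    ...   | inj₂ p = j , p
    level : ∀ i → i ≡ m ⊎ i ≡ suc m → lev i (tailFam {n} m) ≡ n C m
    level zero    (inj₁ refl) = lev-ofSize {n} 0
    level (suc i) (inj₁ refl) = trans
      (cong₂ _+_ (lev-ofSize {n} (suc i)) (lev-ofSize-≢ {n} i (suc i) (<⇒≢ ≤-refl))) (+-identityʳ _)
    level (suc i) (inj₂ refl) = cong₂ _+_ (lev-ofSize-≢ {n} (suc i) i (>⇒≢ ≤-refl)) (lev-ofSize {n} i)
    outside : ∀ i → i < m ⊎ suc m < i → lev i (tailFam {n} m) ≡ 0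
    outside zero    (inj₁ lt) = lev-ofSize-≢ {n} 0 m (<⇒≢ lt)
    outside (suc i) (inj₁ lt) = cong₂ _+_ (lev-ofSize-≢ {n} (suc i) m (<⇒≢ lt))
                                          (lev-ofSize-≢ {n} i m (<⇒≢ (≤-trans (n≤1+n _) lt)))
    outside (suc i) (inj₂ lt) = cong₂ _+_ (lev-ofSize-≢ {n} (suc i) m (>⇒≢ (≤-trans (n≤1+n _) lt)))
                                          (lev-ofSize-≢ {n} i m (>⇒≢ (≤-pred lt)))
    between : ∀ {i} → m ≤ i → i ≤ suc m → i ≡ m ⊎ i ≡ suc m
    between p q with m≤n⇒m<n∨m≡n q
    ... | inj₁ (s≤s r) = inj₁ (≤-antisym r p)
    ... | inj₂ e       = inj₂ e
    prof : HasProfileᵇ m (suc m) (n C m) (tailFam m)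
    prof i = (λ p q → level i (between p q)) , outside i

mutual
  pairFam : ∀ {n} → ℕ → Indicator n
  pairFam m []                  = false
  pairFam m (_ ∷ [])            = false
  pairFam m (false ∷ true  ∷ v) = restFam m v
  pairFam m (false ∷ false ∷ v) = ofSize m v
  pairFam m (true  ∷ _ ∷ v)     = ofSize m v

  -- For `m = 0` the empty family suffices, since the empty set never has trace {2}.
  restFam : ∀ {n} → ℕ → Indicator n
  restFam zero    = ∅
  restFam (suc m) = pairFam m

-- If `x` contains the first point, then `y` has trace {1}, or `y` and hence `z` have trace {1,2}.
-- If `x` has trace {2}, then `z` has trace {1,2} or the trace is constant, and the remainders form
-- the same situation for `m − 1`.
pairFam-meets : ∀ {n} m (x y z : Subset n) → ∣ x ∣ ≡ m → ∣ y ∣ ≡ 1 + m → ∣ z ∣ ≡ 2 + m → x ⊆ y → y ⊆ z →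
                pairFam m x ≡ true ⊎ pairFam m y ≡ true ⊎ pairFam m z ≡ true
pairFam-meets m []             []             []             e e′ () h h′
pairFam-meets m (_ ∷ [])       (_ ∷ [])       (true  ∷ [])   e e′ () h h′
pairFam-meets m (_ ∷ [])       (_ ∷ [])       (false ∷ [])   e e′ () h h′
pairFam-meets m (false ∷ false ∷ u) y z e e′ e″ h h′ = inj₁ (ofSize⁺ u e)
pairFam-meets m (true ∷ b ∷ u) (a′ ∷ b′ ∷ v) (a″ ∷ b″ ∷ w) e e′ e″ h h′ with ⊆-true h
pairFam-meets m (true ∷ b ∷ u) (true ∷ false ∷ v) z e e′ e″ h h′ | refl = inj₂ (inj₁ (ofSize⁺ v (suc-injective e′)))
pairFam-meets m (true ∷ b ∷ u) (true ∷ true ∷ v) (a″ ∷ b″ ∷ w) e e′ e″ h h′ | refl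
  with ⊆-true h′ | ⊆-true (drop-∷-⊆ h′)
... | refl | refl = inj₂ (inj₂ (ofSize⁺ w (suc-injective (suc-injective e″))))
pairFam-meets m (false ∷ true ∷ u) (a′ ∷ b′ ∷ v) (a″ ∷ b″ ∷ w) e e′ e″ h h′ with ⊆-true (drop-∷-⊆ h)
... | refl with ⊆-true (drop-∷-⊆ h′)
pairFam-meets m (false ∷ true ∷ u) (_ ∷ true ∷ v) (true ∷ true ∷ w) e e′ e″ h h′ | refl | refl =
  inj₂ (inj₂ (ofSize⁺ w (suc-injective (suc-injective e″))))
pairFam-meets m (false ∷ true ∷ u) (true ∷ true ∷ v) (false ∷ true ∷ w) e e′ e″ h h′ | refl | refl with ⊆-true h′
... | ()
pairFam-meets zero    (false ∷ true ∷ u) (false ∷ true ∷ v) (false ∷ true ∷ w) () e′ e″ h h′ | refl | refl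
pairFam-meets (suc m) (false ∷ true ∷ u) (false ∷ true ∷ v) (false ∷ true ∷ w) e e′ e″ h h′ | refl | refl =
  pairFam-meets m u v w (suc-injective e) (suc-injective e′) (suc-injective e″)
    (drop-∷-⊆ (drop-∷-⊆ h)) (drop-∷-⊆ (drop-∷-⊆ h′))

pairFam-range : ∀ {n} m (x : Subset n) → pairFam m x ≡ true → m ≤ ∣ x ∣ × ∣ x ∣ ≤ 2 + m
pairFam-range m (false ∷ false ∷ v) p with ofSize⁻ v p
... | refl = ≤-refl , m≤n+m m 2
pairFam-range m (true ∷ false ∷ v) p with ofSize⁻ v p
... | refl = n≤1+n m , n≤1+n (suc m)
pairFam-range m (true ∷ true ∷ v) p with ofSize⁻ v p
... | refl = m≤n+m m 2 , ≤-refl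
pairFam-range (suc m) (false ∷ true ∷ v) p with pairFam-range m v p
... | q , r = s≤s q , s≤s r

levPred : ∀ {n} → ℕ → Indicator n → ℕ
levPred zero    F = 0
levPred (suc r) F = lev r F

-- The summands belong to the traces ∅, {1}, {1,2} and {2}, in this order. For `r = 0` the default 0
-- of `levPred` reflects that a one-element set cannot have trace {1,2}.
lev-pairFam-suc : ∀ {n} r m → lev (suc r) (pairFam {2 + n} m) ≡
  lev (suc r) (ofSize {n} m) + (lev r (ofSize {n} m) + levPred r (ofSize {n} m)) + lev r (restFam {n} m)
lev-pairFam-suc {n} zero m = regroup (lev 1 (ofSize {n} m)) (lev 0 (restFam {n} m)) (lev 0 (ofSize {n} m))
  where regroup : ∀ a b c → a + b + c ≡ a + (c + 0) + b
        regroup = solve-∀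
lev-pairFam-suc {n} (suc r) m =
  regroup (lev (2 + r) (ofSize {n} m)) (lev (suc r) (restFam {n} m)) (lev (suc r) (ofSize {n} m))
          (lev r (ofSize {n} m))
  where regroup : ∀ a b c d → a + b + (c + d) ≡ a + (c + d) + b
        regroup = solve-∀

levPred-ofSize-≢ : ∀ {n} r m → r ≢ suc m → levPred r (ofSize {n} m) ≡ 0
levPred-ofSize-≢     zero    m _   = refl
levPred-ofSize-≢ {n} (suc r) m r≢m = lev-ofSize-≢ {n} r m (r≢m ∘ cong suc)

-- The copies of level `m` sit at total sizes `m`, `m + 1` and `m + 2`, so at each of these one
-- summand counts all `m`-sets and the others vanish.
lev-copies : ∀ {n} r m → suc r ≡ m ⊎ r ≡ m ⊎ r ≡ suc m →
  lev (suc r) (ofSize {n} m) + (lev r (ofSize {n} m) + levPred r (ofSize {n} m)) ≡ n C m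
lev-copies {n} r m (inj₁ refl) = trans
  (cong₂ _+_ (lev-ofSize {n} m) (cong₂ _+_ (lev-ofSize-≢ {n} r m (<⇒≢ ≤-refl))
                                          (levPred-ofSize-≢ {n} r m (<⇒≢ (n≤1+n _)))))
  (+-identityʳ _)
lev-copies {n} r m (inj₂ (inj₁ refl)) = trans
  (cong₂ _+_ (lev-ofSize-≢ {n} (suc r) m (>⇒≢ ≤-refl))
    (cong₂ _+_ (lev-ofSize {n} m) (levPred-ofSize-≢ {n} r m (<⇒≢ ≤-refl))))
  (+-identityʳ _)
lev-copies {n} r m (inj₂ (inj₂ refl)) =
  cong₂ _+_ (lev-ofSize-≢ {n} (suc r) m (>⇒≢ (n≤1+n _)))
    (cong₂ _+_ (lev-ofSize-≢ {n} r m (>⇒≢ ≤-refl)) (lev-ofSize {n} m))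

-- The copies give the leading binomial; the recursive family, at the same offset `d`, gives the
-- rest of the cascade.
lev-pairFam : ∀ {n} m d → d ≤ 2 → suc m + suc m ≤ n → lev (d + m) (pairFam {n} m) ≡ cascade (n ∸ 2) m (suc m)
lev-pairFam {n} m d d≤2 h with 2s≤n⇒n≥2 {n} {m} h
lev-pairFam zero    0 d≤2 h | n , refl , _ = trans (lev-ofSize {n} 0) (sym (+-identityʳ _))
lev-pairFam zero    1 d≤2 h | n , refl , _ =
  trans (lev-pairFam-suc {n} 0 0) (cong₂ _+_ (lev-copies {n} 0 0 (inj₂ (inj₁ refl))) (lev-∅ {n} 0))
lev-pairFam zero    2 d≤2 h | n , refl , _ =
  trans (lev-pairFam-suc {n} 1 0) (cong₂ _+_ (lev-copies {n} 1 0 (inj₂ (inj₂ refl))) (lev-∅ {n} 1))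
lev-pairFam zero    (suc (suc (suc d))) (s≤s (s≤s ())) h | _
lev-pairFam (suc m) d d≤2 h | n , refl , h′ = begin
  lev (d + suc m) (pairFam {2 + n} (suc m)) ≡⟨ cong (λ i → lev i (pairFam {2 + n} (suc m))) (+-suc d m) ⟩
  lev (suc (d + m)) (pairFam {2 + n} (suc m)) ≡⟨ lev-pairFam-suc {n} (d + m) (suc m) ⟩
  _ ≡⟨ cong₂ _+_ (lev-copies {n} (d + m) (suc m) (position d d≤2)) (lev-pairFam {n} m d d≤2 h′) ⟩
  n C suc m + cascade (n ∸ 2) m (suc m) ∎
  where
    open ≡-Reasoning
    position : ∀ d → d ≤ 2 → suc (d + m) ≡ suc m ⊎ d + m ≡ suc m ⊎ d + m ≡ suc (suc m)
    position 0 _ = inj₁ refl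
    position 1 _ = inj₂ (inj₁ refl)
    position 2 _ = inj₂ (inj₂ refl)
    position (suc (suc (suc d))) (s≤s (s≤s ()))

upper₃ : ∀ {n m} → 2 * m + 2 ≤ n → Attained n m (2 + m) (sum3 n m)
upper₃ {n} {m} 2m+2≤n = attained⁺ (pairFam m) cut prof
  where
    2s≤n : suc m + suc m ≤ n
    2s≤n = ≤-trans (≤-reflexive (1+m+1+m≡2m+2 m)) 2m+2≤n
    2+m≤n : 2 + m ≤ n
    2+m≤n = ≤-trans (s≤s (m≤n+m (suc m) m)) 2s≤n
    cut : IsCutsetᵇ (pairFam m)
    cut c with at-level c (≤-trans (m≤n+m m 2) 2+m≤n) | at-level c (≤-trans (n≤1+n _) 2+m≤n) | at-level c 2+m≤n
    ... | i , e , t | j , e′ , t′ | k , e″ , t″ with pairFam-meets m _ _ _ e e′ e″ (step-⊆ c t t′) (step-⊆ c t′ t″)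
    ...   | inj₁ p        = i , p
    ...   | inj₂ (inj₁ p) = j , p
    ...   | inj₂ (inj₂ p) = k , p
    prof : HasProfileᵇ m (2 + m) (sum3 n m) (pairFam {n} m)
    prof i =
      (λ m≤i i≤2+m → trans (subst (λ i → lev i (pairFam {n} m) ≡ _) (m∸n+n≡m m≤i)
          (lev-pairFam {n} m (i ∸ m) (subst (i ∸ m ≤_) (m+n∸n≡m 2 m) (∸-monoˡ-≤ m i≤2+m)) 2s≤n))
        (sym (sum3≡cascade n m))) ,
      (λ out → lev-none i (pairFam {n} m) λ x e → ¬-not λ p →
        [ (λ lt → <⇒≱ lt (subst (m ≤_) e (proj₁ (pairFam-range m x p)))) ,
          (λ lt → <⇒≱ lt (subst (_≤ 2 + m) e (proj₂ (pairFam-range m x p)))) ]′ out)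

theorem1 : (n : ℕ) → 1 ≤ n →
    ((m : ℕ) → m ≤ n → IsG n m m (n C m))
    × ((m : ℕ) → m + 1 ≤ n → IsG n m (m + 1) ((n ∸ 1) C m))
    × ((m : ℕ) → 2 * m + 2 ≤ n → IsG n m (m + 2) (sum3 n m))
theorem1 n@(suc n′) 1≤n =
  (λ m m≤n → upper₁ m≤n , λ _ → lower₁) ,
  (λ m m+1≤n → subst (λ l → IsG n m l (n′ C m)) (+-comm 1 m)
    (upper₂ (≤-pred (subst (_≤ n) (+-comm m 1) m+1≤n)) , λ _ → lower₂)) ,
  (λ m 2m+2≤n → subst (λ l → IsG n m l (sum3 n m)) (+-comm 2 m)
    (upper₃ 2m+2≤n , λ _ → lower₃ 2m+2≤n))
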